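{- Let $f(x)\in\mathbf{Z}[x]$ be a separable polynomial of degree 2, and let $p$ be a good prime for $f(x)$. Then for every integer $m$ coprime to $p$ there exist infinitely many elements $d\in\mathcal{S}(f)$ such that $d\equiv m\pmod p$.
   Context: Squarefree integers may be negative and are nonzero. For a nonzero rational number $r$, its squarefree part $S(r)$ is the unique squarefree integer $d$ such that $r/d$ is a square in $\mathbf{Q}$. For a separable nonconstant $f(x)\in\mathbf{Z}[x]$, $\mathcal{S}(f)=\{S(f(r)) : r\in\mathbf{Q},\ f(r)\neq 0\}$. An odd prime $p$ is good for $f(x)$ if the reduced polynomial $\bar f(x)\in\mathbf{F}_p[x]$ has the same degree as $f(x)$ and has nonzero discriminant. -}

module Defs where

open import Algebra.Bundles.Raw using (RawRing)
open import Data.Integer.Base as ℤ using (ℤ; +_; ∣_∣)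
import Data.Integer.Divisibility as ℤ using (_∣_)
open import Data.List.Base using (List; []; _∷_; map; foldr)
open import Data.Nat.Base as ℕ using (ℕ; zero; suc)
open import Data.Nat.Primality using (Prime)
open import Data.Product.Base using (∃; ∃₂; _×_)
open import Data.Rational.Base as ℚ using (ℚ; 0ℚ; _/_)
open import Function.Base using (id)
open import Function.Definitions using (Injective)
open import Level using (0ℓ)
open import Relation.Binary.PropositionalEquality.Core using (_≡_; _≢_)
open import Relation.Nullary.Negation.Core using (¬_)
open import Relation.Unary using (Pred; _∈_)

-- Polynomials are coefficient lists, constant term first; trailing zeros are
-- allowed, so polynomial equality is _≋_ rather than _≡_.
module Polynomial {c ℓ} (R : RawRing c ℓ) where
  open RawRing R

  Poly : Set c
  Poly = List Carrier

  coeff : Poly → ℕ → Carrier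
  coeff []      _       = 0#
  coeff (a ∷ f) zero    = a
  coeff (a ∷ f) (suc i) = coeff f i

  infix 4 _≋_
  _≋_ : Poly → Poly → Set ℓ
  f ≋ g = ∀ i → coeff f i ≈ coeff g i

  HasDegree : Poly → ℕ → Set ℓ
  HasDegree f n = ¬ (coeff f n ≈ 0#) × (∀ i → n ℕ.< i → coeff f i ≈ 0#)

  eval : Poly → Carrier → Carrier
  eval f x = foldr (λ a v → a + x * v) 0# f

  infixl 6 _⊕_
  _⊕_ : Poly → Poly → Poly
  []      ⊕ g       = g
  (a ∷ f) ⊕ []      = a ∷ f
  (a ∷ f) ⊕ (b ∷ g) = (a + b) ∷ (f ⊕ g)

  infixl 7 _⊗_
  _⊗_ : Poly → Poly → Poly
  []      ⊗ g = []
  (a ∷ f) ⊗ g = map (a *_) g ⊕ (0# ∷ (f ⊗ g))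

  -- (a + x f)′ = f + x f′
  derivative : Poly → Poly
  derivative []      = []
  derivative (a ∷ f) = f ⊕ (0# ∷ derivative f)

  -- f and f′ generate the unit ideal.
  Separable : Poly → Set _
  Separable f = ∃₂ λ u v → (u ⊗ f) ⊕ (v ⊗ derivative f) ≋ (1# ∷ [])

  -- The discriminant b² − 4ac of ax² + bx + c; meaningful in degree 2 only.
  discriminant₂ : Poly → Carrier
  discriminant₂ f = b * b + - ((1# + 1# + 1# + 1#) * (a * c₀))
    where
    a  = coeff f 2
    b  = coeff f 1
    c₀ = coeff f 0

infix 4 _≡_[mod_]
_≡_[mod_] : ℤ → ℤ → ℕ → Set
a ≡ b [mod n ] = + n ℤ.∣ a ℤ.- b

-- ℤ/nℤ, presented as ℤ with congruence modulo n as its equality.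
ℤ/_ℤ : ℕ → RawRing 0ℓ 0ℓ
ℤ/ n ℤ = record
  { Carrier = ℤ
  ; _≈_     = _≡_[mod n ]
  ; _+_     = ℤ._+_
  ; _*_     = ℤ._*_
  ; -_      = ℤ.-_
  ; 0#      = + 0
  ; 1#      = + 1
  }

module ℤ[x] = Polynomial ℤ.+-*-rawRing
module ℚ[x] = Polynomial ℚ.+-*-rawRing
module ℤ/_ℤ[x] (n : ℕ) = Polynomial (ℤ/ n ℤ)

toℚ[x] : ℤ[x].Poly → ℚ[x].Poly
toℚ[x] = map (_/ 1)

reduce : ∀ n → ℤ[x].Poly → ℤ/_ℤ[x].Poly n
reduce n = map id

SeparableOverℚ : ℤ[x].Poly → Set
SeparableOverℚ f = ℚ[x].Separable (toℚ[x] f)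

Squarefree : Pred ℤ 0ℓ
Squarefree d = d ≢ + 0 × (∀ k → k ℤ.* k ℤ.∣ d → ∣ k ∣ ≡ 1)

-- d = S(r) for a nonzero rational r: d is squarefree and r / d is a square in ℚ.
IsSquarefreePart : ℚ → ℤ → Set
IsSquarefreePart r d = Squarefree d × ∃ λ q → r ≡ (d / 1) ℚ.* (q ℚ.* q)

𝒮 : ℤ[x].Poly → Pred ℤ 0ℓ
𝒮 f d = ∃ λ r → f⟨ r ⟩ ≢ 0ℚ × IsSquarefreePart f⟨ r ⟩ d
  where
  f⟨_⟩ : ℚ → ℚ
  f⟨_⟩ = ℚ[x].eval (toℚ[x] f)

-- Good primes of a polynomial of degree 2.
record GoodPrime₂ (p : ℕ) (f : ℤ[x].Poly) : Set where
  open ℤ/_ℤ[x] p using (HasDegree; discriminant₂)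
  open RawRing (ℤ/ p ℤ) using (_≈_; 0#)
  field
    prime      : Prime p
    odd        : p ≢ 2
    sameDegree : ∀ n → ℤ[x].HasDegree f n → HasDegree (reduce p f) n
    disc≉0     : ¬ (discriminant₂ (reduce p f) ≈ 0#)

Infinite : Pred ℤ 0ℓ → Set
Infinite P = ∃ λ (s : ℕ → ℤ) → Injective _≡_ _≡_ s × (∀ i → s i ∈ P)

{-# OPTIONS --safe #-}

-- Let D be the discriminant of f = ax² + bx + c.  Since 4a f(r) = (2ar + b)² − D,
-- a squarefree d lies in 𝒮(f) iff ad is, up to squares, a value of the norm form
-- x² − Dz², and such numbers are closed under multiplication.
--
-- The norm form takes every value modulo p.  Hence there are a squarefree d₀ with
-- ad₀ a norm and g prime to p with d₀g² ≡ m, and a norm n ≡ g that is prime to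
-- any prescribed M.  Every prime ℓ dividing n divides some t² − D, so by descent
-- ℓk is a norm for some 0 < |k| ≤ |D|.  Call (k, ℓ mod p) the type of ℓ: the
-- product of two primes of the same type is a norm.  There are finitely many
-- types; take n prime to all the primes whose type occurs only finitely often.
-- Replacing each prime factor of n by two fresh primes of its type and
-- multiplying everything into d₀ gives a new squarefree d ≡ d₀n² ≡ m.
module Submission where

open import Defs
open import Data.Fin.Base as Fin using (Fin; fromℕ<; toℕ; splitAt)
open import Data.Fin.Properties as Fin using (pigeonhole; toℕ<n; toℕ-fromℕ<; toℕ-injective; splitAt⁻¹-↑ˡ; splitAt⁻¹-↑ʳ)
open import Data.Integer.Base hiding (suc; pred)
open import Data.Integer.Coprimality using (Coprime)
open import Data.Integer.DivMod using (_%ℕ_; _/ℕ_; n%ℕd<d; a≡a%ℕn+[a/ℕn]*n)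
open import Data.Integer.Divisibility.Signed renaming (_∣_ to _∣ₛ_; _∣?_ to _∣ₛ?_)
open import Data.Integer.Properties
open import Data.Integer.Tactic.RingSolver using (solve-∀)
open import Data.List.Base using (List; []; _∷_; _++_; map; upTo; cartesianProduct)
import Data.List.Membership.Propositional as List
open import Data.List.Membership.Propositional.Properties using (∈-map⁺; ∈-++⁺ˡ; ∈-++⁺ʳ; ∈-upTo⁺; ∈-cartesianProduct⁺)
open import Data.List.Relation.Unary.All as All using (All; []; _∷_)
open import Data.Nat.Base as ℕ using (ℕ; zero; suc; _!)
import Data.Nat.Coprimality as ℕ
import Data.Nat.Divisibility as ℕ
import Data.Nat.DivMod as ℕ
open import Data.Nat.GCD using (module Bézout)
open import Data.Nat.Induction using (<-rec)
open import Data.Nat.ListAction using (product)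
open import Data.Nat.Primality using (Prime; euclidsLemma; prime⇒irreducible; prime⇒nonZero; prime⇒nonTrivial)
open import Data.Nat.Primality.Factorisation using (PrimeFactorisation; factorise)
import Data.Nat.Properties as ℕ
open import Data.Product.Base using (∃; ∃₂; _×_; _,_; proj₁; proj₂)
open import Data.Rational.Base as ℚ using (ℚ; 0ℚ; 1ℚ)
import Data.Rational.Properties as ℚ
open import Data.Rational.Solver using (module +-*-Solver)
import Data.Rational.Unnormalised.Base as ℚᵘ
import Data.Rational.Unnormalised.Properties as ℚᵘ
open import Data.Sum.Base using (_⊎_; inj₁; inj₂; [_,_]′)
open import Function.Base using (_∘_; id)
open import Function.Definitions using (Injective)
open import Level using (0ℓ)
open import Relation.Binary.Definitions using (tri<; tri≈; tri>)
open import Relation.Binary.PropositionalEquality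
open import Relation.Nullary using (¬_; yes; no; contradiction)
open import Relation.Unary using (Pred; _∈_)

-- Primes and divisibility in ℤ

prime∣*⇒∣⊎∣ : ∀ {ℓ} → Prime ℓ → ∀ i j → + ℓ ∣ₛ i * j → (+ ℓ ∣ₛ i) ⊎ (+ ℓ ∣ₛ j)
prime∣*⇒∣⊎∣ ℓ-prime i j ℓ∣ij
  with euclidsLemma ∣ i ∣ ∣ j ∣ ℓ-prime (subst (_ ℕ.∣_) (abs-* i j) (∣⇒∣ᵤ ℓ∣ij))
... | inj₁ ℓ∣i = inj₁ (∣ᵤ⇒∣ ℓ∣i)
... | inj₂ ℓ∣j = inj₂ (∣ᵤ⇒∣ ℓ∣j)

prime∤* : ∀ {ℓ} → Prime ℓ → ∀ {i j} → ¬ + ℓ ∣ₛ i → ¬ + ℓ ∣ₛ j → ¬ + ℓ ∣ₛ i * j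
prime∤* ℓ-prime ℓ∤i ℓ∤j = [ ℓ∤i , ℓ∤j ]′ ∘ prime∣*⇒∣⊎∣ ℓ-prime _ _

prime∤ℕ* : ∀ {ℓ} → Prime ℓ → ∀ {m n} → ¬ ℓ ℕ.∣ m → ¬ ℓ ℕ.∣ n → ¬ ℓ ℕ.∣ m ℕ.* n
prime∤ℕ* ℓ-prime ℓ∤m ℓ∤n = [ ℓ∤m , ℓ∤n ]′ ∘ euclidsLemma _ _ ℓ-prime

prime∤1 : ∀ {ℓ} → Prime ℓ → ¬ ℓ ℕ.∣ 1
prime∤1 ℓ-prime ℓ∣1 = ℕ.nonTrivial⇒≢1 {{prime⇒nonTrivial ℓ-prime}} (ℕ.∣1⇒≡1 ℓ∣1)

∤⇒≢0 : ∀ {k i} → ¬ k ∣ₛ i → i ≢ 0ℤ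
∤⇒≢0 k∤0 refl = k∤0 (divides 0ℤ refl)

*-≢0 : ∀ {i j} → i ≢ 0ℤ → j ≢ 0ℤ → i * j ≢ 0ℤ
*-≢0 {i} i≢0 j≢0 = [ i≢0 , j≢0 ]′ ∘ i*j≡0⇒i≡0∨j≡0 i

-- Congruences modulo n

module Congruence (n : ℕ) where

  infix 4 _≈_
  -- Carrying the quotient as data lets a match on `refl` replace the left side by `j + q * + n`,
  -- after which each law is a ring identity.
  record _≈_ (i j : ℤ) : Set where
    constructor congruent
    field
      quotient : ℤ
      equality : i ≡ j + quotient * + n

  ≈-reflexive : ∀ {i j} → i ≡ j → i ≈ j
  ≈-reflexive {i} refl = congruent 0ℤ (sym (+-identityʳ i))

  ≈-refl : ∀ {i} → i ≈ i
  ≈-refl = ≈-reflexive refl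

  ≈-sym : ∀ {i j} → i ≈ j → j ≈ i
  ≈-sym {i} {j} (congruent q refl) = congruent (- q) (lemma j q (+ n))
    where
    lemma : ∀ j q n → j ≡ j + q * n + - q * n
    lemma = solve-∀

  ≈-trans : ∀ {i j k} → i ≈ j → j ≈ k → i ≈ k
  ≈-trans {k = k} (congruent q refl) (congruent r refl) = congruent (r + q) (lemma k q r (+ n))
    where
    lemma : ∀ k q r n → k + r * n + q * n ≡ k + (r + q) * n
    lemma = solve-∀

  +-cong-≈ : ∀ {i j k l} → i ≈ j → k ≈ l → i + k ≈ j + l
  +-cong-≈ {j = j} {l = l} (congruent q refl) (congruent r refl) =
    congruent (q + r) (lemma j l q r (+ n))
    where
    lemma : ∀ j l q r n → j + q * n + (l + r * n) ≡ j + l + (q + r) * n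
    lemma = solve-∀

  *-cong-≈ : ∀ {i j k l} → i ≈ j → k ≈ l → i * k ≈ j * l
  *-cong-≈ {j = j} {l = l} (congruent q refl) (congruent r refl) =
    congruent (j * r + q * l + q * (r * + n)) (lemma j l q r (+ n))
    where
    lemma : ∀ j l q r n → (j + q * n) * (l + r * n) ≡ j * l + (j * r + q * l + q * (r * n)) * n
    lemma = solve-∀

  neg-cong-≈ : ∀ {i j} → i ≈ j → - i ≈ - j
  neg-cong-≈ {j = j} (congruent q refl) = congruent (- q) (lemma j q (+ n))
    where
    lemma : ∀ j q n → - (j + q * n) ≡ - j + - q * n
    lemma = solve-∀

  ≈⇒∣- : ∀ {i j} → i ≈ j → + n ∣ₛ i - j
  ≈⇒∣- {j = j} (congruent q refl) = divides q (lemma j (q * + n))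
    where
    lemma : ∀ j k → j + k - j ≡ k
    lemma = solve-∀

  ∣-⇒≈ : ∀ {i j} → + n ∣ₛ i - j → i ≈ j
  ∣-⇒≈ {i} {j} (divides q eq) = congruent q (trans (lemma i j) (cong (λ k → j + k) eq))
    where
    lemma : ∀ i j → i ≡ j + (i - j)
    lemma = solve-∀

  ∣-resp-≈ : ∀ {i j} → i ≈ j → + n ∣ₛ i → + n ∣ₛ j
  ∣-resp-≈ (congruent q refl) n∣i = ∣m+n∣n⇒∣m n∣i (divides q refl)

  ≈-%ℕ : ∀ i .{{_ : ℕ.NonZero n}} → i ≈ + (i %ℕ n)
  ≈-%ℕ i = congruent (i /ℕ n) (a≡a%ℕn+[a/ℕn]*n i n)

  %ℕ-≡⇒≈ : ∀ i j .{{_ : ℕ.NonZero n}} → i %ℕ n ≡ j %ℕ n → i ≈ j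
  %ℕ-≡⇒≈ i j eq = ≈-trans (≈-%ℕ i) (≈-trans (≈-reflexive (cong +_ eq)) (≈-sym (≈-%ℕ j)))

  ≈-inverse : Prime n → ∀ i → ¬ + n ∣ₛ i → ∃ λ i⁻¹ → i * i⁻¹ ≈ 1ℤ
  ≈-inverse n-prime i n∤i = invert (ℕ.coprime-Bézout (ℕ.prime⇒coprime n-prime {{ℕ.≢-nonZero r≢0}} (n%ℕd<d i n)))
    where
    instance _ = prime⇒nonZero n-prime
    r = i %ℕ n
    i≈r : i ≈ + r
    i≈r = ≈-%ℕ i
    r≢0 : r ≢ 0
    r≢0 r≡0 = n∤i (∣-resp-≈ (≈-sym i≈r) (subst (λ z → + n ∣ₛ + z) (sym r≡0) (divides 0ℤ refl)))
    pos-1+* : ∀ x y → + (1 ℕ.+ x ℕ.* y) ≡ 1ℤ + + x * + y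
    pos-1+* x y = trans (pos-+ 1 (x ℕ.* y)) (cong (λ z → 1ℤ + z) (pos-* x y))
    invert : Bézout.Identity 1 n r → ∃ λ i⁻¹ → i * i⁻¹ ≈ 1ℤ
    -- Here 1 + y r = x n, so -y inverts r; the other sign of Bézout's identity gives y.
    invert (Bézout.+- x y eq) = - + y , ≈-trans (*-cong-≈ i≈r ≈-refl)
      (congruent (- + x) (trans (lemma₁ (+ r) (+ y)) (trans (cong (λ z → 1ℤ - z) eq′) (lemma₂ (+ x) (+ n)))))
      where
      eq′ : 1ℤ + + y * + r ≡ + x * + n
      eq′ = trans (sym (pos-1+* y r)) (trans (cong +_ eq) (pos-* x n))
      lemma₁ : ∀ r y → r * - y ≡ 1ℤ - (1ℤ + y * r)
      lemma₁ = solve-∀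
      lemma₂ : ∀ x n → 1ℤ - x * n ≡ 1ℤ + - x * n
      lemma₂ = solve-∀
    invert (Bézout.-+ x y eq) = + y , ≈-trans (*-cong-≈ i≈r ≈-refl)
      (congruent (+ x) (trans (*-comm (+ r) (+ y)) (sym eq′)))
      where
      eq′ : 1ℤ + + x * + n ≡ + y * + r
      eq′ = trans (sym (pos-1+* x n)) (trans (cong +_ eq) (pos-* y r))

-- Squarefree integers

prime∤⇒coprime : ∀ {ℓ n} → Prime ℓ → ¬ ℓ ℕ.∣ n → ℕ.Coprime n ℓ
prime∤⇒coprime ℓ-prime ℓ∤n (c∣n , c∣ℓ) with prime⇒irreducible ℓ-prime c∣ℓ
... | inj₁ c≡1  = c≡1
... | inj₂ refl = contradiction c∣n ℓ∤n

-- If k² divides dℓ, then ℓ does not divide k, since ℓ² ∣ dℓ would give ℓ ∣ d. So k² is coprime to ℓ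
-- and divides d.
Squarefree-*prime : ∀ {d ℓ} → Squarefree d → Prime ℓ → ¬ (+ ℓ ∣ₛ d) → Squarefree (d * + ℓ)
Squarefree-*prime {d} {ℓ} (d≢0 , squarefree) ℓ-prime ℓ∤d =
  *-≢0 d≢0 (ℕ.≢-nonZero⁻¹ ℓ ∘ +-injective) , only-units
  where
  instance _ = prime⇒nonZero ℓ-prime
  only-units : ∀ k → ∣ k * k ∣ ℕ.∣ ∣ d * + ℓ ∣ → ∣ k ∣ ≡ 1
  only-units k k²∣dℓ = squarefree k (ℕ.coprime-divisor k²⊥ℓ (subst (∣ k * k ∣ ℕ.∣_) (ℕ.*-comm ∣ d ∣ ℓ) k²∣dℓ′))
    where
    k²∣dℓ′ : ∣ k * k ∣ ℕ.∣ ∣ d ∣ ℕ.* ℓ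
    k²∣dℓ′ = subst (∣ k * k ∣ ℕ.∣_) (abs-* d (+ ℓ)) k²∣dℓ
    ℓ∤k : ¬ ℓ ℕ.∣ ∣ k ∣
    ℓ∤k ℓ∣k = ℓ∤d (∣ᵤ⇒∣ (ℕ.*-cancelʳ-∣ ℓ (ℕ.∣-trans (ℕ.*-pres-∣ ℓ∣k ℓ∣k) (subst (ℕ._∣ _) (abs-* k k) k²∣dℓ′))))
    k²⊥ℓ : ℕ.Coprime ∣ k * k ∣ ℓ
    k²⊥ℓ = prime∤⇒coprime ℓ-prime (subst (λ n → ¬ ℓ ℕ.∣ n) (sym (abs-* k k)) (prime∤ℕ* ℓ-prime ℓ∤k ℓ∤k))

Squarefree-factor : ∀ d {k} → Squarefree (d * k) → Squarefree d
Squarefree-factor d {k} (dk≢0 , squarefree) =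
  (λ d≡0 → dk≢0 (cong (_* k) d≡0)) ,
  λ j j²∣d → squarefree j (subst (_ ℕ.∣_) (sym (abs-* d k)) (ℕ.∣m⇒∣m*n ∣ k ∣ j²∣d))

SquarefreeDecomposition : ℤ → Set
SquarefreeDecomposition i = ∃₂ λ d q → Squarefree d × i ≡ d * (q * q)

-- Starting from the sign of i, the prime factors of |i| are absorbed one at a time: a prime not
-- dividing d joins d, and one dividing d leaves it for q.
squarefreeDecomposition : ∀ i → i ≢ 0ℤ → SquarefreeDecomposition i
squarefreeDecomposition i i≢0 =
  subst SquarefreeDecomposition (unit*abs i)
    (decompose (unit i) 1ℤ (unit-squarefree i) (factorise ∣ i ∣ {{ℕ.≢-nonZero (i≢0 ∘ ∣i∣≡0⇒i≡0)}}))
  where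
  unit : ℤ → ℤ
  unit i = sign i ◃ 1

  unit*abs : ∀ i → unit i * (1ℤ * 1ℤ) * + ∣ i ∣ ≡ i
  unit*abs (+ n)    = *-identityˡ (+ n)
  unit*abs -[1+ n ] = -1*i≡-i +[1+ n ]

  ∣1⇒abs≡1 : ∀ k → ∣ k * k ∣ ℕ.∣ 1 → ∣ k ∣ ≡ 1
  ∣1⇒abs≡1 k k²∣1 = ℕ.∣1⇒≡1 (ℕ.m*n∣⇒m∣ ∣ k ∣ ∣ k ∣ (subst (ℕ._∣ 1) (abs-* k k) k²∣1))

  unit-squarefree : ∀ i → Squarefree (unit i)
  unit-squarefree (+ _)    = (λ ()) , λ k k²∣1 → ∣1⇒abs≡1 k k²∣1
  unit-squarefree -[1+ _ ] = (λ ()) , λ k k²∣1 → ∣1⇒abs≡1 k k²∣1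

  decomposeList : ∀ d q ls → Squarefree d → All Prime ls → SquarefreeDecomposition (d * (q * q) * + product ls)
  decomposeList d q [] sf [] = d , q , sf , *-identityʳ _
  decomposeList d q (ℓ ∷ ls) sf (ℓ-prime ∷ ls-prime) with + ℓ ∣ₛ? d
  ... | no ℓ∤d = subst SquarefreeDecomposition eq
      (decomposeList (d * + ℓ) q ls (Squarefree-*prime sf ℓ-prime ℓ∤d) ls-prime)
    where
    lemma : ∀ d q l r → d * l * (q * q) * r ≡ d * (q * q) * (l * r)
    lemma = solve-∀
    eq : d * + ℓ * (q * q) * + product ls ≡ d * (q * q) * + product (ℓ ∷ ls)
    eq = trans (lemma d q (+ ℓ) (+ product ls)) (cong (d * (q * q) *_) (sym (pos-* ℓ (product ls))))
  ... | yes (divides c refl) = subst SquarefreeDecomposition eq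
      (decomposeList c (q * + ℓ) ls (Squarefree-factor c sf) ls-prime)
    where
    lemma : ∀ c q l r → c * (q * l * (q * l)) * r ≡ c * l * (q * q) * (l * r)
    lemma = solve-∀
    eq : c * (q * + ℓ * (q * + ℓ)) * + product ls ≡ c * + ℓ * (q * q) * + product (ℓ ∷ ls)
    eq = trans (lemma c q (+ ℓ) (+ product ls)) (cong (c * + ℓ * (q * q) *_) (sym (pos-* ℓ (product ls))))

  decompose : ∀ d q {n} → Squarefree d → PrimeFactorisation n → SquarefreeDecomposition (d * (q * q) * + n)
  decompose d q sf record { factors = ls ; isFactorisation = refl ; factorsPrime = primes } =
    decomposeList d q ls sf primes

-- The norm form x² - D z² over ℚ, and descent

module Norm (D : ℤ) (D≢0 : D ≢ 0ℤ) where

  -- A value of x² - D z² at rational arguments, with the common denominator `q` cleared. Rational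
  -- arguments make the property depend on n only up to nonzero squares.
  record IsNorm (n : ℤ) : Set where
    constructor norm
    field
      x z q    : ℤ
      q≢0      : q ≢ 0ℤ
      equality : n * (q * q) ≡ x * x - D * (z * z)

  IsNorm-* : ∀ {m n} → IsNorm m → IsNorm n → IsNorm (m * n)
  IsNorm-* {m} {n} (norm x z q q≢0 eq) (norm x′ z′ q′ q′≢0 eq′) =
    norm (x * x′ + D * (z * z′)) (x * z′ + x′ * z) (q * q′) (*-≢0 q≢0 q′≢0)
      (trans (lemma₁ m n q q′) (trans (cong₂ _*_ eq eq′) (brahmagupta D x x′ z z′)))
    where
    lemma₁ : ∀ m n q r → m * n * (q * r * (q * r)) ≡ m * (q * q) * (n * (r * r))
    lemma₁ = solve-∀
    brahmagupta : ∀ D x y z w → (x * x - D * (z * z)) * (y * y - D * (w * w))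
      ≡ (x * y + D * (z * w)) * (x * y + D * (z * w)) - D * ((x * w + y * z) * (x * w + y * z))
    brahmagupta = solve-∀

  IsNorm-square : ∀ n → IsNorm (n * n)
  IsNorm-square n = norm n 0ℤ 1ℤ (λ ()) (lemma D n)
    where
    lemma : ∀ D n → n * n * (1ℤ * 1ℤ) ≡ n * n - D * (0ℤ * 0ℤ)
    lemma = solve-∀

  IsNorm-cancel-square : ∀ m {n} → n ≢ 0ℤ → IsNorm (m * (n * n)) → IsNorm m
  IsNorm-cancel-square m {n} n≢0 (norm x z q q≢0 eq) =
    norm x z (n * q) (*-≢0 n≢0 q≢0) (trans (lemma m n q) eq)
    where
    lemma : ∀ m n q → m * (n * q * (n * q)) ≡ m * (n * n) * (q * q)
    lemma = solve-∀

  -- The two norms multiply to mn times k². This is how two primes sharing a cofactor k combine into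
  -- a norm.
  IsNorm-cancel-common : ∀ m n {k} → k ≢ 0ℤ → IsNorm (m * k) → IsNorm (n * k) → IsNorm (m * n)
  IsNorm-cancel-common m n {k} k≢0 mk nk =
    IsNorm-cancel-square (m * n) k≢0 (subst IsNorm (lemma m n k) (IsNorm-* mk nk))
    where
    lemma : ∀ m n k → m * k * (n * k) ≡ m * n * (k * k)
    lemma = solve-∀

  -- n = ((n + 1) / 2)² − ((n − 1) / 2)².
  square⇒IsNorm : ∀ t → D ≡ t * t → ∀ n → IsNorm n
  square⇒IsNorm t D≡t² n =
    norm (t * (n + 1ℤ)) (n - 1ℤ) (+ 2 * t) (*-≢0 {+ 2} (λ ()) t≢0)
      (trans (lemma t n) (cong (λ D → t * (n + 1ℤ) * (t * (n + 1ℤ)) - D * ((n - 1ℤ) * (n - 1ℤ))) (sym D≡t²)))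
    where
    t≢0 : t ≢ 0ℤ
    t≢0 refl = D≢0 D≡t²
    lemma : ∀ t n → n * (+ 2 * t * (+ 2 * t)) ≡ t * (n + 1ℤ) * (t * (n + 1ℤ)) - t * t * ((n - 1ℤ) * (n - 1ℤ))
    lemma = solve-∀

  -- The bound does not depend on n, so only finitely many cofactors k can occur.
  SmallCofactor : ℤ → Set
  SmallCofactor n = ∃ λ k → k ≢ 0ℤ × ∣ k ∣ ℕ.≤ ∣ D ∣ × IsNorm (n * k)

  abs-D≥1 : 1 ℕ.≤ ∣ D ∣
  abs-D≥1 = ℕ.n≢0⇒n>0 (D≢0 ∘ ∣i∣≡0⇒i≡0)

  reduce-root : ∀ n .{{_ : ℕ.NonZero ∣ n ∣}} t → n ∣ₛ t * t - D → n ∣ₛ + (t %ℕ ∣ n ∣) * + (t %ℕ ∣ n ∣) - D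
  reduce-root n t n∣t²-D = subst (n ∣ₛ_)
    (trans (cong (λ u → u * u - D - (+ r + u) * (c * + ∣ n ∣)) t≡) (lemma D (+ r) (c * + ∣ n ∣)))
    (∣m∣n⇒∣m-n n∣t²-D (∣n⇒∣m*n (+ r + t) (∣n⇒∣m*n c m∣∣m∣)))
    where
    r = t %ℕ ∣ n ∣
    c = t /ℕ ∣ n ∣
    t≡ : t ≡ + r + c * + ∣ n ∣
    t≡ = a≡a%ℕn+[a/ℕn]*n t ∣ n ∣
    lemma : ∀ D r v → (r + v) * (r + v) - D - (r + (r + v)) * v ≡ r * r - D
    lemma = solve-∀

  -- From r < |n| and |D| < |n| follows r² + |D| < (r + 1)|n| ≤ |n|².
  cofactor-< : ∀ n w r → r ℕ.< ∣ n ∣ → ∣ D ∣ ℕ.< ∣ n ∣ → + r * + r - D ≡ w * n → ∣ w ∣ ℕ.< ∣ n ∣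
  cofactor-< n w r r<n D<n eq = ℕ.*-cancelʳ-< (∣ n ∣) (∣ w ∣) (∣ n ∣) (begin-strict
    ∣ w ∣ ℕ.* ∣ n ∣          ≡⟨ abs-* w n ⟨
    ∣ w * n ∣                ≡⟨ cong ∣_∣ eq ⟨
    ∣ + r * + r - D ∣        ≤⟨ ∣i-j∣≤∣i∣+∣j∣ (+ r * + r) D ⟩
    ∣ + r * + r ∣ ℕ.+ ∣ D ∣  ≡⟨ cong (ℕ._+ ∣ D ∣) (abs-* (+ r) (+ r)) ⟩
    r ℕ.* r ℕ.+ ∣ D ∣        <⟨ ℕ.+-mono-≤-< (ℕ.*-monoʳ-≤ r (ℕ.<⇒≤ r<n)) D<n ⟩
    r ℕ.* ∣ n ∣ ℕ.+ ∣ n ∣    ≡⟨ ℕ.+-comm (r ℕ.* ∣ n ∣) (∣ n ∣) ⟩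
    suc r ℕ.* ∣ n ∣          ≤⟨ ℕ.*-monoˡ-≤ ∣ n ∣ r<n ⟩
    ∣ n ∣ ℕ.* ∣ n ∣          ∎)
    where open ℕ.≤-Reasoning

  -- Reducing the root t modulo n makes the cofactor w of t² − D = w n smaller
  -- than n, and n w is a norm: so n may be replaced by w.
  smallCofactor : ∀ n t → n ≢ 0ℤ → n ∣ₛ t * t - D → SmallCofactor n
  smallCofactor n t = <-rec P step ∣ n ∣ n t refl
    where
    P : ℕ → Set
    P s = ∀ n t → ∣ n ∣ ≡ s → n ≢ 0ℤ → n ∣ₛ t * t - D → SmallCofactor n
    step : ∀ s → (∀ {s′} → s′ ℕ.< s → P s′) → P s
    step s rec n t refl n≢0 n∣t²-D with ∣ n ∣ ℕ.≤? ∣ D ∣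
    ... | yes n≤D = n , n≢0 , n≤D , IsNorm-square n
    ... | no  n≰D = continue (reduce-root n t n∣t²-D)
      where
      instance _ = ℕ.≢-nonZero (n≢0 ∘ ∣i∣≡0⇒i≡0)
      r = t %ℕ ∣ n ∣
      continue : n ∣ₛ + r * + r - D → SmallCofactor n
      continue (divides w eq) with w ≟ 0ℤ
      -- A zero cofactor means D = r², and then every integer is a norm.
      ... | yes refl = 1ℤ , (λ ()) , abs-D≥1 , square⇒IsNorm (+ r) (sym (i-j≡0⇒i≡j _ _ eq)) (n * 1ℤ)
      ... | no w≢0
        with k , k≢0 , k≤D , wk ← rec (cofactor-< n w r (n%ℕd<d t ∣ n ∣) (ℕ.≰⇒> n≰D) eq) w (+ r) refl w≢0
                                    (divides n (trans eq (*-comm w n)))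
        = k , k≢0 , k≤D ,
          IsNorm-cancel-common n k w≢0 (norm (+ r) 1ℤ 1ℤ (λ ()) (trans (lemma₁ n w) (trans (sym eq) (lemma₂ D (+ r)))))
            (subst IsNorm (*-comm w k) wk)
        where
        lemma₁ : ∀ n w → n * w * (1ℤ * 1ℤ) ≡ w * n
        lemma₁ = solve-∀
        lemma₂ : ∀ D r → r * r - D ≡ r * r - D * (1ℤ * 1ℤ)
        lemma₂ = solve-∀

  module _ {ℓ} (ℓ-prime : Prime ℓ) where
    open Congruence ℓ

    -- With u inverse to z modulo ℓ, x u is a square root of D modulo ℓ, the starting point of the
    -- descent.
    prime-smallCofactor : ∀ x z → ¬ (+ ℓ ∣ₛ z) → + ℓ ∣ₛ x * x - D * (z * z) → SmallCofactor (+ ℓ)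
    prime-smallCofactor x z ℓ∤z ℓ∣norm with u , congruent c zu≡1+cℓ ← ≈-inverse ℓ-prime z ℓ∤z =
      smallCofactor (+ ℓ) (x * u) (ℕ.≢-nonZero⁻¹ ℓ {{prime⇒nonZero ℓ-prime}} ∘ +-injective)
        (subst (+ ℓ ∣ₛ_) (lemma D x z u)
          (∣m∣n⇒∣m+n (∣n⇒∣m*n (u * u) ℓ∣norm) (∣n⇒∣m*n (D * (z * u + 1ℤ)) (≈⇒∣- (congruent {z * u} {1ℤ} c zu≡1+cℓ)))))
      where
      lemma : ∀ D x z u → u * u * (x * x - D * (z * z)) + D * (z * u + 1ℤ) * (z * u - 1ℤ) ≡ x * u * (x * u) - D
      lemma = solve-∀

-- Values of the norm form modulo p

∣∧abs<⇒≡0 : ∀ {n i} → + n ∣ₛ i → ∣ i ∣ ℕ.< n → i ≡ 0ℤ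
∣∧abs<⇒≡0 {n} {i} n∣i i<n with ∣ i ∣ ℕ.≟ 0
... | yes ∣i∣≡0 = ∣i∣≡0⇒i≡0 ∣i∣≡0
... | no  ∣i∣≢0 = contradiction (ℕ.∣⇒≤ {{ℕ.≢-nonZero ∣i∣≢0}} (∣⇒∣ᵤ n∣i)) (ℕ.<⇒≱ i<n)

oddPrime : ∀ {p} → Prime p → p ≢ 2 → ∃ λ h → p ≡ suc (h ℕ.+ h)
oddPrime {p} p-prime p≢2 with p ℕ.% 2 in eq | ℕ.m%n<n p 2
... | 0 | _ with prime⇒irreducible p-prime (ℕ.m%n≡0⇒n∣m p 2 eq)
...   | inj₂ 2≡p = contradiction (sym 2≡p) p≢2
oddPrime {p} p-prime p≢2 | 1 | _ =
  p ℕ./ 2 , trans (ℕ.m≡m%n+[m/n]*n p 2) (cong₂ ℕ._+_ eq (*2 (p ℕ./ 2)))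
  where
  *2 : ∀ n → n ℕ.* 2 ≡ n ℕ.+ n
  *2 n = trans (ℕ.*-comm n 2) (cong (n ℕ.+_) (ℕ.+-identityʳ n))
oddPrime {p} p-prime p≢2 | suc (suc _) | ℕ.s≤s (ℕ.s≤s ())

prime∤! : ∀ {p} → Prime p → ∀ {n} → n ℕ.< p → ¬ p ℕ.∣ n !
prime∤! p-prime {zero}  _   = prime∤1 p-prime
prime∤! p-prime {suc n} n<p = prime∤ℕ* p-prime
  (λ p∣1+n → ℕ.<⇒≱ n<p (ℕ.∣⇒≤ p∣1+n)) (prime∤! p-prime (ℕ.<-trans (ℕ.n<1+n n) n<p))

≤⇒∣! : ∀ {m n} .{{_ : ℕ.NonZero m}} → m ℕ.≤ n → m ℕ.∣ n !
≤⇒∣! {suc m} m≤n = ℕ.∣-trans (ℕ.m∣m*n (m !)) (ℕ.m≤n⇒m!∣n! m≤n)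

module NormValues (D : ℤ) {p : ℕ} (p-prime : Prime p) (p≢2 : p ≢ 2) (p∤D : ¬ (+ p ∣ₛ D)) where
  open Congruence p
  private instance _ = prime⇒nonZero p-prime

  -- p divides i - j or i + j, both smaller than p in absolute value, so one of them vanishes; if it
  -- is the sum, then i = j = 0.
  square-injective : ∀ {i j} → i ℕ.+ j ℕ.< p → + i * + i ≈ + j * + j → i ≡ j
  square-injective {i} {j} i+j<p i²≈j²
    with prime∣*⇒∣⊎∣ p-prime (+ i - + j) (+ i + + j) (subst (+ p ∣ₛ_) (lemma (+ i) (+ j)) (≈⇒∣- i²≈j²))
    where
    lemma : ∀ i j → i * i - j * j ≡ (i - j) * (i + j)
    lemma = solve-∀
  ... | inj₁ p∣i-j = +-injective (i-j≡0⇒i≡j _ _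
          (∣∧abs<⇒≡0 p∣i-j (ℕ.≤-<-trans (∣i-j∣≤∣i∣+∣j∣ (+ i) (+ j)) i+j<p)))
  ... | inj₂ p∣i+j = trans (ℕ.m+n≡0⇒m≡0 i i+j≡0) (sym (ℕ.m+n≡0⇒n≡0 i i+j≡0))
    where
    i+j≡0 : i ℕ.+ j ≡ 0
    i+j≡0 = +-injective (∣∧abs<⇒≡0 p∣i+j i+j<p)

  cancel-affine : ∀ c i j → c + D * i ≈ c + D * j → i ≈ j
  cancel-affine c i j eq = ∣-⇒≈ ([ (λ p∣D → contradiction p∣D p∤D) , id ]′
    (prime∣*⇒∣⊎∣ p-prime D (i - j) (subst (+ p ∣ₛ_) (lemma D c i j) (≈⇒∣- eq))))
    where
    lemma : ∀ D c i j → c + D * i - (c + D * j) ≡ D * (i - j)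
    lemma = solve-∀

  -- Both x² and c + D z² take (p + 1) / 2 values modulo p, so they share one.
  represents : ∀ c → ∃₂ λ x z → x * x - D * (z * z) ≈ c
  represents c with h , p≡1+2h ← oddPrime p-prime p≢2 = collide (pigeonhole p<size residue)
    where
    p<size : p ℕ.< suc h ℕ.+ suc h
    p<size = ℕ.≤-reflexive (trans (cong suc p≡1+2h) (cong suc (sym (ℕ.+-suc h h))))

    small : ∀ (i j : Fin (suc h)) → toℕ i ℕ.+ toℕ j ℕ.< p
    small i j = ℕ.≤-trans (ℕ.s≤s (ℕ.+-mono-≤ (ℕ.s≤s⁻¹ (toℕ<n i)) (ℕ.s≤s⁻¹ (toℕ<n j)))) (ℕ.≤-reflexive (sym p≡1+2h))

    square : Fin (suc h) → ℤ
    square i = + toℕ i * + toℕ i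

    -- The first h + 1 = (p + 1) / 2 indices carry the squares, the last h + 1 the values c + D z².
    value : Fin (suc h ℕ.+ suc h) → ℤ
    value i = [ square , (λ j → c + D * square j) ]′ (splitAt (suc h) i)

    residue : Fin (suc h ℕ.+ suc h) → Fin p
    residue i = fromℕ< (n%ℕd<d (value i) p)

    residue≡⇒value≈ : ∀ i j → residue i ≡ residue j → value i ≈ value j
    residue≡⇒value≈ i j eq = %ℕ-≡⇒≈ _ _
      (trans (sym (toℕ-fromℕ< _)) (trans (cong toℕ eq) (toℕ-fromℕ< (n%ℕd<d (value j) p))))

    solution : ∀ i j → square i ≈ c + D * square j → ∃₂ λ x z → x * x - D * (z * z) ≈ c
    solution i j eq = + toℕ i , + toℕ j ,
      ≈-trans (+-cong-≈ eq ≈-refl) (≈-reflexive (lemma c (D * square j)))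
      where
      lemma : ∀ c k → c + k - k ≡ c
      lemma = solve-∀

    collide : (∃₂ λ i j → i Fin.< j × residue i ≡ residue j) → ∃₂ λ x z → x * x - D * (z * z) ≈ c
    collide (i , j , i<j , eq)
      with splitAt (suc h) i in eqᵢ | splitAt (suc h) j in eqⱼ | residue≡⇒value≈ i j eq
    -- Each block is injective modulo p, so a collision must link the two blocks.
    ... | inj₁ a | inj₁ b | vᵢ≈vⱼ = contradiction
          (trans (sym (splitAt⁻¹-↑ˡ eqᵢ)) (trans
            (cong (Fin._↑ˡ suc h) (toℕ-injective (square-injective (small a b) vᵢ≈vⱼ)))
            (splitAt⁻¹-↑ˡ eqⱼ)))
          (Fin.<⇒≢ i<j)
    ... | inj₂ a | inj₂ b | vᵢ≈vⱼ = contradiction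
          (trans (sym (splitAt⁻¹-↑ʳ {i = i} eqᵢ)) (trans
            (cong (suc h Fin.↑ʳ_) (toℕ-injective (square-injective (small a b) (cancel-affine c _ _ vᵢ≈vⱼ))))
            (splitAt⁻¹-↑ʳ eqⱼ)))
          (Fin.<⇒≢ i<j)
    ... | inj₁ a | inj₂ b | vᵢ≈vⱼ = solution a b vᵢ≈vⱼ
    ... | inj₂ a | inj₁ b | vᵢ≈vⱼ = solution b a (≈-sym vᵢ≈vⱼ)

  -- `large` guarantees a prime factor to replace, `avoidsM` keeps the prime factors away from the
  -- primes of exhausted types, and `avoidsz` makes z invertible modulo each prime factor.
  record CoprimeNorm (c : ℤ) (M : ℕ) : Set where
    field
      x z     : ℤ
      value≈  : x * x - D * (z * z) ≈ c
      large   : 2 ℕ.≤ ∣ x * x - D * (z * z) ∣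
      avoidsM : ∀ {ℓ} → Prime ℓ → + ℓ ∣ₛ x * x - D * (z * z) → ¬ ℓ ℕ.∣ M
      avoidsz : ∀ {ℓ} → Prime ℓ → + ℓ ∣ₛ x * x - D * (z * z) → ¬ (+ ℓ ∣ₛ z)

  private
    module Value (L w j : ℕ) where
      x = 1ℤ + + L * + j
      z = + L * + w
      n = x * x - D * (z * z)

      n+Dz²≡x² : n + D * (z * z) ≡ x * x
      n+Dz²≡x² = lemma (x * x) (D * (z * z))
        where
        lemma : ∀ i k → i - k + k ≡ i
        lemma = solve-∀

      -- A prime dividing both n and L divides z, hence x², hence x; but x ≡ 1 modulo L.
      avoidsL : ∀ {ℓ} → Prime ℓ → + ℓ ∣ₛ n → ¬ ℓ ℕ.∣ L
      avoidsL {ℓ} ℓ-prime ℓ∣n ℓ∣L =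
        prime∤1 ℓ-prime (∣⇒∣ᵤ (∣m+n∣n⇒∣m {m = 1ℤ} {+ L * + j} ℓ∣x (∣m⇒∣m*n (+ j) ℓ∣L′)))
        where
        ℓ∣L′ : + ℓ ∣ₛ + L
        ℓ∣L′ = ∣ᵤ⇒∣ ℓ∣L
        ℓ∣x : + ℓ ∣ₛ x
        ℓ∣x = [ id , id ]′ (prime∣*⇒∣⊎∣ ℓ-prime x x (subst (+ ℓ ∣ₛ_) n+Dz²≡x²
          (∣m∣n⇒∣m+n ℓ∣n (∣n⇒∣m*n D (∣m⇒∣m*n z (∣m⇒∣m*n (+ w) ℓ∣L′))))))

      -- z does not involve j, so j can be taken large enough for x² to outgrow D z².
      large : L ≢ 0 → 2 ℕ.+ ∣ D * (z * z) ∣ ℕ.≤ j → 2 ℕ.≤ ∣ n ∣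
      large L≢0 B≤j = ℕ.+-cancelʳ-≤ (∣ D * (z * z) ∣) 2 (∣ n ∣) (begin
        2 ℕ.+ ∣ D * (z * z) ∣      ≤⟨ B≤j ⟩
        j                          ≤⟨ ℕ.m≤n*m j L ⟩
        L ℕ.* j                    ≤⟨ ℕ.n≤1+n (L ℕ.* j) ⟩
        suc (L ℕ.* j)              ≤⟨ ℕ.m≤m*n (suc (L ℕ.* j)) (suc (L ℕ.* j)) ⟩
        suc (L ℕ.* j) ℕ.* suc (L ℕ.* j)  ≡⟨ cong₂ ℕ._*_ ∣x∣≡ ∣x∣≡ ⟨
        ∣ x ∣ ℕ.* ∣ x ∣            ≡⟨ abs-* x x ⟨
        ∣ x * x ∣                  ≡⟨ cong ∣_∣ n+Dz²≡x² ⟨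
        ∣ n + D * (z * z) ∣        ≤⟨ ∣i+j∣≤∣i∣+∣j∣ n (D * (z * z)) ⟩
        ∣ n ∣ ℕ.+ ∣ D * (z * z) ∣  ∎)
        where
        open ℕ.≤-Reasoning
        instance _ = ℕ.≢-nonZero L≢0
        ∣x∣≡ : ∣ x ∣ ≡ suc (L ℕ.* j)
        ∣x∣≡ = cong (λ k → ∣ 1ℤ + k ∣) (sym (pos-* L j))

      -- A prime dividing w is at most p, and it is not p because p does not divide n; so it divides
      -- (p - 1)! and hence L.
      avoidsz : ∀ {ℓ} → Prime ℓ → ¬ (+ p ∣ₛ n) → w ≢ 0 → w ℕ.≤ p → ℕ.pred p ! ℕ.∣ L →
                + ℓ ∣ₛ n → ¬ (+ ℓ ∣ₛ z)
      avoidsz {ℓ} ℓ-prime p∤n w≢0 w≤p !∣L ℓ∣n ℓ∣z with prime∣*⇒∣⊎∣ ℓ-prime (+ L) (+ w) ℓ∣z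
      ... | inj₁ ℓ∣L = avoidsL ℓ-prime ℓ∣n (∣⇒∣ᵤ ℓ∣L)
      ... | inj₂ ℓ∣w = avoidsL ℓ-prime ℓ∣n
              (ℕ.∣-trans (≤⇒∣! {{prime⇒nonZero ℓ-prime}} (ℕ.<⇒≤pred ℓ<p)) !∣L)
        where
        instance _ = ℕ.≢-nonZero w≢0
        ℓ<p : ℓ ℕ.< p
        ℓ<p = ℕ.≤∧≢⇒< (ℕ.≤-trans (ℕ.∣⇒≤ (∣⇒∣ᵤ ℓ∣w)) w≤p) λ { refl → p∤n ℓ∣n }

      value≈ : ∀ {x₀ z₀} → + L * + j ≈ x₀ - 1ℤ → z ≈ z₀ → n ≈ x₀ * x₀ - D * (z₀ * z₀)
      value≈ {x₀} Lj≈ z≈ =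
        +-cong-≈ (*-cong-≈ x≈ x≈) (neg-cong-≈ (*-cong-≈ (≈-refl {D}) (*-cong-≈ z≈ z≈)))
        where
        lemma : ∀ i → 1ℤ + (i - 1ℤ) ≡ i
        lemma = solve-∀
        x≈ : x ≈ x₀
        x≈ = ≈-trans (+-cong-≈ (≈-refl {1ℤ}) Lj≈) (≈-reflexive (lemma x₀))

  -- Residues run from 1 to p instead of from 0: the primes dividing w are bounded by w only if w ≠
  -- 0.
  positiveResidue : ∀ i → ∃ λ w → w ≢ 0 × w ℕ.≤ p × (+ w ≈ i)
  positiveResidue i = suc r , (λ ()) , n%ℕd<d (i - 1ℤ) p ,
    ≈-trans (+-cong-≈ (≈-refl {1ℤ}) (≈-sym (≈-%ℕ (i - 1ℤ)))) (≈-reflexive (lemma i))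
    where
    r = (i - 1ℤ) %ℕ p
    lemma : ∀ i → 1ℤ + (i - 1ℤ) ≡ i
    lemma = solve-∀

  largeResidue : ∀ i B → ∃ λ j → B ℕ.≤ j × (+ j ≈ i)
  largeResidue i B = r ℕ.+ p ℕ.* B , ℕ.≤-trans (ℕ.m≤n*m B p) (ℕ.m≤n+m (p ℕ.* B) r) ,
    ≈-trans (congruent (+ B) eq) (≈-sym (≈-%ℕ i))
    where
    r = i %ℕ p
    eq : + (r ℕ.+ p ℕ.* B) ≡ + r + + B * + p
    eq = trans (pos-+ r (p ℕ.* B)) (cong (λ k → + r + k) (trans (pos-* p B) (*-comm (+ p) (+ B))))

  solve-≈ : ∀ {i} → ¬ (+ p ∣ₛ i) → ∀ k → ∃ λ j → i * j ≈ k
  solve-≈ {i} p∤i k with i⁻¹ , ii⁻¹≈1 ← ≈-inverse p-prime i p∤i =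
    i⁻¹ * k , ≈-trans (≈-reflexive (sym (*-assoc i i⁻¹ k)))
      (≈-trans (*-cong-≈ ii⁻¹≈1 (≈-refl {k})) (≈-reflexive (*-identityˡ k)))

  -- x ≡ 1 and z ≡ 0 modulo L make the value prime to L; the factor (p − 1)! of L
  -- takes care of the primes dividing z / L ≤ p.
  private
    coprimeNorm′ : ∀ c M L → ¬ (+ p ∣ₛ c) → ¬ p ℕ.∣ L → M ℕ.∣ L → ℕ.pred p ! ℕ.∣ L → CoprimeNorm c M
    coprimeNorm′ c M L p∤c p∤L M∣L !∣L
      with x₀ , z₀ , value₀ ← represents c
      with w₀ , Lw₀≈z₀ ← solve-≈ {+ L} (p∤L ∘ ∣⇒∣ᵤ) z₀
      with j₀ , Lj₀≈x₀-1 ← solve-≈ {+ L} (p∤L ∘ ∣⇒∣ᵤ) (x₀ - 1ℤ)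
      with w , w≢0 , w≤p , w≈w₀ ← positiveResidue w₀
      with j , B≤j , j≈j₀ ← largeResidue j₀ (2 ℕ.+ ∣ D * (+ L * + w * (+ L * + w)) ∣) = record
      { x       = x
      ; z       = z
      ; value≈  = n≈c
      ; large   = large (λ { refl → p∤L (p ℕ.∣0) }) B≤j
      ; avoidsM = λ ℓ-prime ℓ∣n ℓ∣M → avoidsL ℓ-prime ℓ∣n (ℕ.∣-trans ℓ∣M M∣L)
      ; avoidsz = λ ℓ-prime → avoidsz ℓ-prime (p∤c ∘ ∣-resp-≈ n≈c) w≢0 w≤p !∣L
      }
      where
      open Value L w j
      n≈c : n ≈ c
      n≈c = ≈-trans (value≈ {x₀} (≈-trans (*-cong-≈ (≈-refl {+ L}) j≈j₀) Lj₀≈x₀-1)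
                            (≈-trans (*-cong-≈ (≈-refl {+ L}) w≈w₀) Lw₀≈z₀)) value₀

  coprimeNorm : ∀ c M → ¬ (+ p ∣ₛ c) → ¬ p ℕ.∣ M → CoprimeNorm c M
  coprimeNorm c M p∤c p∤M = coprimeNorm′ c M (M ℕ.* ℕ.pred p !) p∤c
    (prime∤ℕ* p-prime p∤M (prime∤! p-prime (ℕ.≤-reflexive (ℕ.suc-pred p))))
    (ℕ.m∣m*n (ℕ.pred p !)) (ℕ.n∣m*n M)

-- Squarefree d in the class of m with a d a norm

abs-square : ∀ i → + ∣ i ∣ * + ∣ i ∣ ≡ i * i
abs-square (+ _)    = refl
abs-square -[1+ _ ] = refl

factor∣product : ∀ ls → All (ℕ._∣ product ls) ls
factor∣product []       = []
factor∣product (ℓ ∷ ls) = ℕ.m∣m*n (product ls) ∷ All.map (ℕ.∣n⇒∣m*n ℓ) (factor∣product ls)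

integers≤ : ℕ → List ℤ
integers≤ n = map +_ (upTo (suc n)) ++ map -[1+_] (upTo n)

∈-integers≤ : ∀ {n} i → ∣ i ∣ ℕ.≤ n → i List.∈ integers≤ n
∈-integers≤     (+ i)    i≤n = ∈-++⁺ˡ (∈-map⁺ +_ (∈-upTo⁺ (ℕ.s≤s i≤n)))
∈-integers≤ {n} -[1+ i ] i<n = ∈-++⁺ʳ (map +_ (upTo (suc n))) (∈-map⁺ -[1+_] (∈-upTo⁺ i<n))

module SquarefreeNorms
  (D a m : ℤ) {p : ℕ} (p-prime : Prime p) (p≢2 : p ≢ 2)
  (p∤D : ¬ (+ p ∣ₛ D)) (p∤a : ¬ (+ p ∣ₛ a)) (p∤m : ¬ (+ p ∣ₛ m)) where

  open Congruence p
  open Norm D (∤⇒≢0 p∤D)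
  open NormValues D p-prime p≢2 p∤D
  private instance _ = prime⇒nonZero p-prime

  record SquarefreeNorm (d : ℤ) : Set where
    field
      squarefree : Squarefree d
      p∤d        : ¬ (+ p ∣ₛ d)
      isNorm     : IsNorm (a * d)

  -- Take v = x² - D z² ≡ am and let d be the squarefree part of av = dq². Then adq² = a²v is the
  -- value at (ax, az), and g = q/a modulo p gives dg² ≡ av/a² ≡ m.
  initial : ∃₂ λ d g → SquarefreeNorm d × ¬ (+ p ∣ₛ g) × (d * (g * g) ≈ m)
  initial
    with x , z , v≈am ← represents (a * m)
    with b , ab≈1 ← ≈-inverse p-prime a p∤a
    with d , q , squarefree , av≡dq² ← squarefreeDecomposition (a * (x * x - D * (z * z)))
           (∤⇒≢0 (prime∤* p-prime p∤a (prime∤* p-prime p∤a p∤m ∘ ∣-resp-≈ v≈am)))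
    = d , q * b , record { squarefree = squarefree ; p∤d = p∤d ; isNorm = isNorm } , p∤g , dg²≈m
    where
    v = x * x - D * (z * z)
    p∤av : ¬ (+ p ∣ₛ a * v)
    p∤av = prime∤* p-prime p∤a (prime∤* p-prime p∤a p∤m ∘ ∣-resp-≈ v≈am)
    p∤d : ¬ (+ p ∣ₛ d)
    p∤d p∣d = p∤av (subst (+ p ∣ₛ_) (sym av≡dq²) (∣m⇒∣m*n (q * q) p∣d))
    isNorm : IsNorm (a * d)
    isNorm = norm (a * x) (a * z) q q≢0
      (trans (*-assoc a d (q * q)) (trans (cong (a *_) (sym av≡dq²)) (lemma D a x z)))
      where
      q≢0 : q ≢ 0ℤ
      q≢0 refl = p∤av (subst (+ p ∣ₛ_) (sym (trans av≡dq² (*-zeroʳ d))) (divides 0ℤ refl))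
      lemma : ∀ D a x z → a * (a * (x * x - D * (z * z))) ≡ a * x * (a * x) - D * (a * z * (a * z))
      lemma = solve-∀
    dg²≈m : d * (q * b * (q * b)) ≈ m
    dg²≈m = ≈-trans (≈-reflexive (trans (lemma₁ d q b) (cong (_* (b * b)) (sym av≡dq²))))
      (≈-trans (*-cong-≈ (*-cong-≈ (≈-refl {a}) v≈am) (≈-refl {b * b}))
      (≈-trans (≈-reflexive (lemma₂ a b m))
      (≈-trans (*-cong-≈ (*-cong-≈ ab≈1 ab≈1) (≈-refl {m})) (≈-reflexive (*-identityˡ m)))))
      where
      lemma₁ : ∀ d q b → d * (q * b * (q * b)) ≡ d * (q * q) * (b * b)
      lemma₁ = solve-∀
      lemma₂ : ∀ a b m → a * (a * m) * (b * b) ≡ a * b * (a * b) * m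
      lemma₂ = solve-∀
    p∤g : ¬ (+ p ∣ₛ q * b)
    p∤g p∣g = p∤m (∣-resp-≈ dg²≈m (∣n⇒∣m*n d (∣m⇒∣m*n (q * b) p∣g)))

  -- Newness is phrased as not dividing M, where M will be a multiple of every solution already
  -- found.
  record NewSolution (M : ℕ) : Set where
    field
      d              : ℤ
      squarefreeNorm : SquarefreeNorm d
      d≈m            : d ≈ m
      d∤M            : ¬ ∣ d ∣ ℕ.∣ M

  PrimeType : Set
  PrimeType = ℤ × ℕ

  record HasType (τ : PrimeType) (ℓ : ℕ) : Set where
    constructor hasType
    field
      prime    : Prime ℓ
      p∤ℓ      : ¬ p ℕ.∣ ℓ
      k≢0      : proj₁ τ ≢ 0ℤ
      ℓk-norm  : IsNorm (+ ℓ * proj₁ τ)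
      residue  : + ℓ ≈ + proj₂ τ

  types : List PrimeType
  types = cartesianProduct (integers≤ ∣ D ∣) (upTo p)

  typeOf : ∀ {ℓ} → Prime ℓ → ¬ p ℕ.∣ ℓ → SmallCofactor (+ ℓ) → ∃ λ τ → τ List.∈ types × HasType τ ℓ
  typeOf {ℓ} ℓ-prime p∤ℓ (k , k≢0 , k≤D , ℓk-norm) =
    (k , + ℓ %ℕ p) ,
    ∈-cartesianProduct⁺ (∈-integers≤ k k≤D) (∈-upTo⁺ (n%ℕd<d (+ ℓ) p)) ,
    hasType ℓ-prime p∤ℓ k≢0 ℓk-norm (≈-%ℕ (+ ℓ))

  -- Avoiding `d * + ℓ₁` makes ℓ₂ differ from ℓ₁ as well, so the result stays squarefree. The common
  -- cofactor makes ℓ₁ℓ₂ a norm.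
  adjoin : ∀ {τ d ℓ₁ ℓ₂} → SquarefreeNorm d → HasType τ ℓ₁ → HasType τ ℓ₂ →
           ¬ ℓ₁ ℕ.∣ ∣ d ∣ → ¬ ℓ₂ ℕ.∣ ∣ d * + ℓ₁ ∣ → SquarefreeNorm (d * + ℓ₁ * + ℓ₂)
  adjoin {_} {d} {ℓ₁} {ℓ₂} d-norm t₁ t₂ ℓ₁∤d ℓ₂∤dℓ₁ = record
    { squarefree = Squarefree-*prime (Squarefree-*prime squarefree (prime t₁) (ℓ₁∤d ∘ ∣⇒∣ᵤ))
                     (prime t₂) (ℓ₂∤dℓ₁ ∘ ∣⇒∣ᵤ)
    ; p∤d        = prime∤* p-prime (prime∤* p-prime p∤d (p∤ℓ t₁ ∘ ∣⇒∣ᵤ)) (p∤ℓ t₂ ∘ ∣⇒∣ᵤ)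
    ; isNorm     = subst IsNorm (lemma a d (+ ℓ₁) (+ ℓ₂))
                     (IsNorm-* isNorm (IsNorm-cancel-common (+ ℓ₁) (+ ℓ₂) (k≢0 t₁) (ℓk-norm t₁) (ℓk-norm t₂)))
    }
    where
    open HasType
    open SquarefreeNorm d-norm
    lemma : ∀ a d k l → a * d * (k * l) ≡ a * (d * k * l)
    lemma = solve-∀

  -- Constructively one cannot decide whether a type has infinitely many primes.
  -- Reading "false" as the goal (Friedman's A-translation) makes the dichotomy
  -- available inside the continuation monad ◇.
  module _ (M₀ : ℕ) (p∤M₀ : ¬ p ℕ.∣ M₀) where

    ◇ : Set → Set
    ◇ P = (P → NewSolution M₀) → NewSolution M₀

    Unlimited : PrimeType → Set
    Unlimited τ = ∀ M → ¬ p ℕ.∣ M → ◇ (∃ λ ℓ → ¬ ℓ ℕ.∣ M × HasType τ ℓ)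

    Exhausted : PrimeType → ℕ → Set
    Exhausted τ M = ∀ ℓ → ¬ ℓ ℕ.∣ M → HasType τ ℓ → NewSolution M₀

    Dichotomy : PrimeType → ℕ → Set
    Dichotomy τ M = Unlimited τ ⊎ Exhausted τ M

    weaken : ∀ {τ M N} → M ℕ.∣ N → Dichotomy τ M → Dichotomy τ N
    weaken M∣N (inj₁ unlimited) = inj₁ unlimited
    weaken M∣N (inj₂ exhausted) = inj₂ λ ℓ ℓ∤N → exhausted ℓ λ ℓ∣M → ℓ∤N (ℕ.∣-trans ℓ∣M M∣N)

    -- The first answer claims that τ is unlimited. When a prime avoiding some M is requested, the
    -- continuation is run again with the answer that τ is exhausted at M; any prime refuting this
    -- answers the pending request.
    dichotomy : ∀ τ → ◇ (∃ λ M → ¬ p ℕ.∣ M × Dichotomy τ M)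
    dichotomy τ k = k (1 , prime∤1 p-prime , inj₁ λ M p∤M found →
      k (M , p∤M , inj₂ λ ℓ ℓ∤M t → found (ℓ , ℓ∤M , t)))

    -- A single M serves all the types, because exhaustion persists when M is replaced by a
    -- multiple.
    dichotomies : ∀ τs → ◇ (∃ λ M → ¬ p ℕ.∣ M × All (λ τ → Dichotomy τ M) τs)
    dichotomies []       k = k (1 , prime∤1 p-prime , [])
    dichotomies (τ ∷ τs) k =
      dichotomy τ λ (M , p∤M , δ) → dichotomies τs λ (N , p∤N , δs) →
        k (M ℕ.* N , prime∤ℕ* p-prime p∤M p∤N ,
           weaken (ℕ.m∣m*n N) δ ∷ All.map (weaken (ℕ.n∣m*n M)) δs)

    Replaceable : ℕ → Set
    Replaceable ℓ = ∃₂ λ τ M → HasType τ ℓ × ¬ ℓ ℕ.∣ M × Dichotomy τ M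

    replace : ∀ {d ℓ} → SquarefreeNorm d → Replaceable ℓ →
              ◇ (∃ λ e → SquarefreeNorm e × ∣ d ∣ ℕ.∣ ∣ e ∣ × ¬ ∣ e ∣ ℕ.∣ M₀ × (e ≈ d * (+ ℓ * + ℓ)))
    -- Since ℓ itself avoids M, an exhausted type yields the goal at once, without calling `k`.
    replace {d} {ℓ} d-norm (τ , M , t , ℓ∤M , inj₂ exhausted) k = exhausted ℓ ℓ∤M t
    replace {d} {ℓ} d-norm (τ , M , t , ℓ∤M , inj₁ unlimited) k =
      -- That ℓ₁ does not divide M₀ keeps its multiple e from dividing M₀; that it does not divide d
      -- keeps e squarefree.
      unlimited (M₀ ℕ.* ∣ d ∣) (prime∤ℕ* p-prime p∤M₀ (p∤d ∘ ∣ᵤ⇒∣)) λ (ℓ₁ , ℓ₁∤M₀d , t₁) →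
      unlimited ∣ d * + ℓ₁ ∣ (prime∤* p-prime {d} {+ ℓ₁} p∤d (p∤ℓ t₁ ∘ ∣⇒∣ᵤ) ∘ ∣ᵤ⇒∣) λ (ℓ₂ , ℓ₂∤dℓ₁ , t₂) →
      k (d * + ℓ₁ * + ℓ₂ ,
         adjoin d-norm t₁ t₂ (ℓ₁∤M₀d ∘ ℕ.∣n⇒∣m*n M₀) ℓ₂∤dℓ₁ ,
         ∣⇒∣ᵤ (∣m⇒∣m*n (+ ℓ₂) (∣m⇒∣m*n (+ ℓ₁) (∣-refl {d}))) ,
         (λ e∣M₀ → ℓ₁∤M₀d (ℕ.∣m⇒∣m*n (∣ d ∣) (ℕ.∣-trans (∣⇒∣ᵤ (∣m⇒∣m*n (+ ℓ₂) (∣n⇒∣m*n d (∣-refl {+ ℓ₁})))) e∣M₀))) ,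
         ≈-trans (≈-reflexive (*-assoc d (+ ℓ₁) (+ ℓ₂)))
           (*-cong-≈ (≈-refl {d}) (*-cong-≈ (same t₁) (same t₂))))
      where
      open SquarefreeNorm d-norm
      open HasType
      same : ∀ {ℓ′} → HasType τ ℓ′ → + ℓ′ ≈ + ℓ
      same t′ = ≈-trans (residue t′) (≈-sym (residue t))

    -- One replacement already gives an integer not dividing M₀, and later ones only pass to
    -- multiples of it. The bound 2 ≤ `product ls` excludes the empty list, where nothing is
    -- replaced.
    replaceAll : ∀ {d ls} → SquarefreeNorm d → All Replaceable ls →
                 ◇ (∃ λ e → SquarefreeNorm e × ∣ d ∣ ℕ.∣ ∣ e ∣ × (2 ℕ.≤ product ls → ¬ ∣ e ∣ ℕ.∣ M₀) ×
                            (e ≈ d * (+ product ls * + product ls)))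
    replaceAll {d} {[]} d-norm [] k =
      k (d , d-norm , ℕ.∣-refl , (λ { (ℕ.s≤s ()) }) , ≈-reflexive (sym (*-identityʳ d)))
    replaceAll {d} {ℓ ∷ ls} d-norm (ρ ∷ ρs) k =
      replace d-norm ρ λ (e , e-norm , d∣e , e∤M₀ , e≈) →
      replaceAll e-norm ρs λ (e′ , e′-norm , e∣e′ , _ , e′≈) →
      k (e′ , e′-norm , ℕ.∣-trans d∣e e∣e′ , (λ _ → e∤M₀ ∘ ℕ.∣-trans e∣e′) ,
         ≈-trans e′≈ (≈-trans (*-cong-≈ e≈ (≈-refl {+ product ls * + product ls})) (≈-reflexive eq)))
      where
      lemma : ∀ d k l → d * (k * k) * (l * l) ≡ d * (k * l * (k * l))
      lemma = solve-∀
      eq : d * (+ ℓ * + ℓ) * (+ product ls * + product ls) ≡ d * (+ product (ℓ ∷ ls) * + product (ℓ ∷ ls))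
      eq = trans (lemma d (+ ℓ) (+ product ls)) (cong (λ i → d * (i * i)) (sym (pos-* ℓ (product ls))))

    replaceFactors : ∀ {d n} → SquarefreeNorm d → PrimeFactorisation n →
                     (∀ {ℓ} → Prime ℓ × ℓ ℕ.∣ n → Replaceable ℓ) →
                     2 ℕ.≤ n → d * (+ n * + n) ≈ m → NewSolution M₀
    replaceFactors {d} {n} d-norm record { factors = ls ; isFactorisation = n≡∏ls ; factorsPrime = primes }
                   replaceable 2≤n dn²≈m =
      replaceAll d-norm (All.map replaceable (All.zip (primes , divisors)))
        λ (e , e-norm , _ , e∤M₀ , e≈) → record
          { d              = e
          ; squarefreeNorm = e-norm
          ; d≈m            = ≈-trans e≈ (subst (λ k → d * (+ k * + k) ≈ m) n≡∏ls dn²≈m)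
          ; d∤M            = e∤M₀ (subst (2 ℕ.≤_) n≡∏ls 2≤n)
          }
      where
      divisors : All (ℕ._∣ n) ls
      divisors = subst (λ k → All (ℕ._∣ k) ls) (sym n≡∏ls) (factor∣product ls)

    module _ {M} (δs : All (λ τ → Dichotomy τ M) types) {g} (p∤g : ¬ (+ p ∣ₛ g)) (cn : CoprimeNorm g M) where
      open CoprimeNorm cn

      private
        n = x * x - D * (z * z)

        p∤n : ¬ (+ p ∣ₛ n)
        p∤n = p∤g ∘ ∣-resp-≈ value≈

        replaceable : ∀ {ℓ} → Prime ℓ × ℓ ℕ.∣ ∣ n ∣ → Replaceable ℓ
        replaceable {ℓ} (ℓ-prime , ℓ∣∣n∣) =
          let τ , τ∈types , t = typeOf ℓ-prime p∤ℓ (prime-smallCofactor ℓ-prime x z (avoidsz ℓ-prime ℓ∣n) ℓ∣n)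
          in τ , M , t , avoidsM ℓ-prime ℓ∣n , All.lookup δs τ∈types
          where
          ℓ∣n : + ℓ ∣ₛ n
          ℓ∣n = ∣ᵤ⇒∣ {+ ℓ} {n} ℓ∣∣n∣
          p∤ℓ : ¬ p ℕ.∣ ℓ
          p∤ℓ p∣ℓ = p∤n (∣ᵤ⇒∣ {+ p} {n} (ℕ.∣-trans p∣ℓ ℓ∣∣n∣))

      replaceNorm : ∀ {d} → SquarefreeNorm d → d * (g * g) ≈ m → NewSolution M₀
      replaceNorm {d} d-norm dg²≈m =
        replaceFactors {n = ∣ n ∣} d-norm (factorise ∣ n ∣) replaceable large
          (≈-trans (*-cong-≈ (≈-refl {d}) n²≈g²) dg²≈m)
        where
        instance _ = ℕ.>-nonZero (ℕ.≤-trans (ℕ.s≤s ℕ.z≤n) large)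
        n²≈g² : + ∣ n ∣ * + ∣ n ∣ ≈ g * g
        n²≈g² = ≈-trans (≈-reflexive (abs-square n)) (*-cong-≈ value≈ value≈)

    newSolution : NewSolution M₀
    -- M is fixed before the norm n ≡ g is chosen, so that n can be made prime to it.
    newSolution = dichotomies types λ (M , p∤M , δs) →
      let d , g , d-norm , p∤g , dg²≈m = initial
      in replaceNorm δs p∤g (coprimeNorm g M p∤g p∤M) d-norm dg²≈m

-- From norms to values of f

ι : ℤ → ℚ
ι i = i ℚ./ 1

-- `ι` normalises fractions, so the law is verified among unnormalised rationals, where equality is
-- cross-multiplication.
ι-+ : ∀ i j → ι (i + j) ≡ ι i ℚ.+ ι j
ι-+ i j = ℚ.toℚᵘ-injective (begin
  ℚ.toℚᵘ (ι (i + j))                        ≈⟨ ℚ.toℚᵘ-fromℚᵘ (ℚᵘ.mkℚᵘ (i + j) 0) ⟩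
  ℚᵘ.mkℚᵘ (i + j) 0                         ≈⟨ ℚᵘ.*≡* (cong (_* 1ℤ) (cong₂ _+_ (sym (*-identityʳ i)) (sym (*-identityʳ j)))) ⟩
  ℚᵘ.mkℚᵘ i 0 ℚᵘ.+ ℚᵘ.mkℚᵘ j 0              ≈⟨ ℚᵘ.+-cong (ℚ.toℚᵘ-fromℚᵘ (ℚᵘ.mkℚᵘ i 0)) (ℚ.toℚᵘ-fromℚᵘ (ℚᵘ.mkℚᵘ j 0)) ⟨
  ℚ.toℚᵘ (ι i) ℚᵘ.+ ℚ.toℚᵘ (ι j)            ≈⟨ ℚ.toℚᵘ-homo-+ (ι i) (ι j) ⟨
  ℚ.toℚᵘ (ι i ℚ.+ ι j)                      ∎)
  where open ℚᵘ.≃-Reasoning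

ι-* : ∀ i j → ι (i * j) ≡ ι i ℚ.* ι j
ι-* i j = ℚ.toℚᵘ-injective (begin
  ℚ.toℚᵘ (ι (i * j))                        ≈⟨ ℚ.toℚᵘ-fromℚᵘ (ℚᵘ.mkℚᵘ (i * j) 0) ⟩
  ℚᵘ.mkℚᵘ i 0 ℚᵘ.* ℚᵘ.mkℚᵘ j 0              ≈⟨ ℚᵘ.*-cong (ℚ.toℚᵘ-fromℚᵘ (ℚᵘ.mkℚᵘ i 0)) (ℚ.toℚᵘ-fromℚᵘ (ℚᵘ.mkℚᵘ j 0)) ⟨
  ℚ.toℚᵘ (ι i) ℚᵘ.* ℚ.toℚᵘ (ι j)            ≈⟨ ℚ.toℚᵘ-homo-* (ι i) (ι j) ⟨
  ℚ.toℚᵘ (ι i ℚ.* ι j)                      ∎)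
  where open ℚᵘ.≃-Reasoning

ι≡0⇒≡0 : ∀ {i} → ι i ≡ 0ℚ → i ≡ 0ℤ
ι≡0⇒≡0 {i} eq with ℚ.fromℚᵘ-injective {ℚᵘ.mkℚᵘ i 0} {ℚᵘ.mkℚᵘ 0ℤ 0} eq
... | ℚᵘ.*≡* i*1≡0 = trans (sym (*-identityʳ i)) i*1≡0

ι-inverse : ∀ {i} → i ≢ 0ℤ → ∃ λ y → ι i ℚ.* y ≡ 1ℚ
ι-inverse {i} i≢0 = ℚ.1/ ι i , ℚ.*-inverseʳ (ι i)
  where instance _ = ℚ.≢-nonZero (i≢0 ∘ ι≡0⇒≡0)

-- The argument UY is U/(AV). Padding the lower terms with powers of AVY = 1 turns the value into
-- AY² times the quadratic form of the hypothesis.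
quadratic-value : ∀ {A B C N Q U V Y} → A ℚ.* V ℚ.* Y ≡ 1ℚ →
  A ℚ.* N ℚ.* (Q ℚ.* Q) ≡ U ℚ.* U ℚ.+ U ℚ.* B ℚ.* V ℚ.+ A ℚ.* C ℚ.* (V ℚ.* V) →
  C ℚ.+ U ℚ.* Y ℚ.* (B ℚ.+ U ℚ.* Y ℚ.* (A ℚ.+ U ℚ.* Y ℚ.* 0ℚ)) ≡ N ℚ.* (Q ℚ.* A ℚ.* Y ℚ.* (Q ℚ.* A ℚ.* Y))
quadratic-value {A} {B} {C} {N} {Q} {U} {V} {Y} AVY≡1 eq = begin
  C ℚ.+ U ℚ.* Y ℚ.* (B ℚ.+ U ℚ.* Y ℚ.* (A ℚ.+ U ℚ.* Y ℚ.* 0ℚ))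
    ≡⟨ solve 5 (λ A B C U Y → C :+ U :* Y :* (B :+ U :* Y :* (A :+ U :* Y :* con 0ℚ))
                 := A :* U :* U :* Y :* Y :+ U :* B :* Y :* con 1ℚ :+ C :* (con 1ℚ :* con 1ℚ)) refl A B C U Y ⟩
  A ℚ.* U ℚ.* U ℚ.* Y ℚ.* Y ℚ.+ U ℚ.* B ℚ.* Y ℚ.* 1ℚ ℚ.+ C ℚ.* (1ℚ ℚ.* 1ℚ)
    ≡⟨ cong (λ E → A ℚ.* U ℚ.* U ℚ.* Y ℚ.* Y ℚ.+ U ℚ.* B ℚ.* Y ℚ.* E ℚ.+ C ℚ.* (E ℚ.* E)) AVY≡1 ⟨
  A ℚ.* U ℚ.* U ℚ.* Y ℚ.* Y ℚ.+ U ℚ.* B ℚ.* Y ℚ.* (A ℚ.* V ℚ.* Y) ℚ.+ C ℚ.* (A ℚ.* V ℚ.* Y ℚ.* (A ℚ.* V ℚ.* Y))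
    ≡⟨ solve 6 (λ A B C U V Y → A :* U :* U :* Y :* Y :+ U :* B :* Y :* (A :* V :* Y) :+ C :* (A :* V :* Y :* (A :* V :* Y))
                 := A :* Y :* Y :* (U :* U :+ U :* B :* V :+ A :* C :* (V :* V))) refl A B C U V Y ⟩
  A ℚ.* Y ℚ.* Y ℚ.* (U ℚ.* U ℚ.+ U ℚ.* B ℚ.* V ℚ.+ A ℚ.* C ℚ.* (V ℚ.* V))
    ≡⟨ cong (A ℚ.* Y ℚ.* Y ℚ.*_) eq ⟨
  A ℚ.* Y ℚ.* Y ℚ.* (A ℚ.* N ℚ.* (Q ℚ.* Q))
    ≡⟨ solve 4 (λ A N Q Y → A :* Y :* Y :* (A :* N :* (Q :* Q)) := N :* (Q :* A :* Y :* (Q :* A :* Y))) refl A N Q Y ⟩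
  N ℚ.* (Q ℚ.* A ℚ.* Y ℚ.* (Q ℚ.* A ℚ.* Y)) ∎
  where
  open ≡-Reasoning
  open +-*-Solver

-- Zeros may trail the coefficient of x² in a list of degree 2; they do not affect its values.
eval-zero : ∀ g → (∀ i → ℤ[x].coeff g i ≡ 0ℤ) → ∀ r → ℚ[x].eval (toℚ[x] g) r ≡ 0ℚ
eval-zero []      _    r = refl
eval-zero (e ∷ g) zero≡ r = begin
  ι e ℚ.+ r ℚ.* ℚ[x].eval (toℚ[x] g) r  ≡⟨ cong₂ (λ i v → ι i ℚ.+ r ℚ.* v) (zero≡ 0) (eval-zero g (zero≡ ∘ suc) r) ⟩
  0ℚ ℚ.+ r ℚ.* 0ℚ                       ≡⟨ ℚ.+-identityˡ (r ℚ.* 0ℚ) ⟩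
  r ℚ.* 0ℚ                              ≡⟨ ℚ.*-zeroʳ r ⟩
  0ℚ                                    ∎
  where open ≡-Reasoning

module _ (a b c : ℤ) (g : ℤ[x].Poly) (a≢0 : a ≢ 0ℤ) (g≡0 : ∀ i → ℤ[x].coeff g i ≡ 0ℤ) where

  private
    f : ℤ[x].Poly
    f = c ∷ b ∷ a ∷ g

    D : ℤ
    D = b * b - + 4 * (a * c)

  -- r = (x / z − b) / 2a, since 4a f(r) = (2ar + b)² − D.
  norm⇒∈𝒮 : ∀ {d} x z q → Squarefree d → z ≢ 0ℤ → q ≢ 0ℤ →
             a * d * (q * q) ≡ x * x - D * (z * z) → d ∈ 𝒮 f
  norm⇒∈𝒮 {d} x z q squarefree z≢0 q≢0 eq
    with y , avy≡1 ← ι-inverse {a * (+ 2 * z)} (*-≢0 a≢0 (*-≢0 {+ 2} (λ ()) z≢0))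
    = ι u ℚ.* y , f⟨r⟩≢0 , squarefree , ι q ℚ.* ι a ℚ.* y , f⟨r⟩≡
    where
    u = x - b * z
    v = + 2 * z
    r = ι u ℚ.* y

    -- The right side is a v² f(r) with r = u / (a v).
    eqℤ : a * d * (q * q) ≡ u * u + u * b * v + a * c * (v * v)
    eqℤ = trans eq (lemma a b c x z)
      where
      lemma : ∀ a b c x z → x * x - (b * b - + 4 * (a * c)) * (z * z)
        ≡ (x - b * z) * (x - b * z) + (x - b * z) * b * (+ 2 * z) + a * c * (+ 2 * z * (+ 2 * z))
      lemma = solve-∀

    ι-*₃ : ∀ i j k → ι (i * j * k) ≡ ι i ℚ.* ι j ℚ.* ι k
    ι-*₃ i j k = trans (ι-* (i * j) k) (cong (ℚ._* ι k) (ι-* i j))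

    ι-*-square : ∀ i j k → ι (i * j * (k * k)) ≡ ι i ℚ.* ι j ℚ.* (ι k ℚ.* ι k)
    ι-*-square i j k = trans (ι-*₃ i j (k * k)) (cong (ι i ℚ.* ι j ℚ.*_) (ι-* k k))

    eqℚ : ι a ℚ.* ι d ℚ.* (ι q ℚ.* ι q) ≡ ι u ℚ.* ι u ℚ.+ ι u ℚ.* ι b ℚ.* ι v ℚ.+ ι a ℚ.* ι c ℚ.* (ι v ℚ.* ι v)
    eqℚ = trans (sym (ι-*-square a d q)) (trans (cong ι eqℤ)
      (trans (ι-+ (u * u + u * b * v) (a * c * (v * v)))
        (cong₂ ℚ._+_ (trans (ι-+ (u * u) (u * b * v)) (cong₂ ℚ._+_ (ι-* u u) (ι-*₃ u b v))) (ι-*-square a c v))))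

    ιaιvy≡1 : ι a ℚ.* ι v ℚ.* y ≡ 1ℚ
    ιaιvy≡1 = trans (cong (ℚ._* y) (sym (ι-* a v))) avy≡1

    f⟨r⟩≡ : ℚ[x].eval (toℚ[x] f) r ≡ ι d ℚ.* (ι q ℚ.* ι a ℚ.* y ℚ.* (ι q ℚ.* ι a ℚ.* y))
    f⟨r⟩≡ = trans (cong (λ e → ι c ℚ.+ r ℚ.* (ι b ℚ.+ r ℚ.* (ι a ℚ.+ r ℚ.* e))) (eval-zero g g≡0 r))
      (quadratic-value {ι a} {ι b} {ι c} {ι d} {ι q} {ι u} {ι v} {y} ιaιvy≡1 eqℚ)

    -- As a v y = 1, multiplying f(r) by v² gives dq², which is nonzero.
    f⟨r⟩≢0 : ℚ[x].eval (toℚ[x] f) r ≢ 0ℚ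
    f⟨r⟩≢0 f⟨r⟩≡0 = *-≢0 (proj₁ squarefree) (*-≢0 q≢0 q≢0) (ι≡0⇒≡0 (begin
      ι (d * (q * q))
        ≡⟨ trans (ι-* d (q * q)) (cong (ι d ℚ.*_) (ι-* q q)) ⟩
      ι d ℚ.* (ι q ℚ.* ι q)
        ≡⟨ ℚ.*-identityʳ _ ⟨
      ι d ℚ.* (ι q ℚ.* ι q) ℚ.* (1ℚ ℚ.* 1ℚ)
        ≡⟨ cong (λ e → ι d ℚ.* (ι q ℚ.* ι q) ℚ.* (e ℚ.* e)) ιaιvy≡1 ⟨
      ι d ℚ.* (ι q ℚ.* ι q) ℚ.* (ι a ℚ.* ι v ℚ.* y ℚ.* (ι a ℚ.* ι v ℚ.* y))
        ≡⟨ solve 5 (λ D Q A V Y → D :* (Q :* Q) :* (A :* V :* Y :* (A :* V :* Y))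
                     := D :* (Q :* A :* Y :* (Q :* A :* Y)) :* (V :* V)) refl (ι d) (ι q) (ι a) (ι v) y ⟩
      ι d ℚ.* (ι q ℚ.* ι a ℚ.* y ℚ.* (ι q ℚ.* ι a ℚ.* y)) ℚ.* (ι v ℚ.* ι v)
        ≡⟨ cong (ℚ._* (ι v ℚ.* ι v)) (trans (sym f⟨r⟩≡) f⟨r⟩≡0) ⟩
      0ℚ ℚ.* (ι v ℚ.* ι v)
        ≡⟨ ℚ.*-zeroˡ (ι v ℚ.* ι v) ⟩
      0ℚ ∎))
      where
      open ≡-Reasoning
      open +-*-Solver

  module _ (D≢0 : D ≢ 0ℤ) where
    open Norm D D≢0

    -- D cannot equal both 1 and 4.
    nonsquare-witness : ∃ λ s → s ≢ 0ℤ × D - s * s ≢ 0ℤ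
    nonsquare-witness with D ≟ 1ℤ
    ... | no  D≢1 = 1ℤ , (λ ()) , D≢1 ∘ i-j≡0⇒i≡j D 1ℤ
    ... | yes D≡1 = + 2 , (λ ()) , λ D-4≡0 → contradiction (trans (sym D≡1) (i-j≡0⇒i≡j D (+ 4) D-4≡0)) λ ()

    -- If z = 0, multiply by (D + s²)² − D (2s)² = (D − s²)² to make z nonzero.
    IsNorm⇒∈𝒮 : ∀ {d} → Squarefree d → IsNorm (a * d) → d ∈ 𝒮 f
    IsNorm⇒∈𝒮 {d} squarefree (norm x z q q≢0 eq) with z ≟ 0ℤ
    ... | no  z≢0 = norm⇒∈𝒮 x z q squarefree z≢0 q≢0 eq
    ... | yes refl with s , s≢0 , D-s²≢0 ← nonsquare-witness =
      norm⇒∈𝒮 (x * (D + s * s)) (x * (+ 2 * s)) (q * (D - s * s)) squarefree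
        (*-≢0 x≢0 (*-≢0 {+ 2} (λ ()) s≢0)) (*-≢0 q≢0 D-s²≢0)
        (trans (lemma₁ (a * d) q (D - s * s)) (trans (cong (_* ((D - s * s) * (D - s * s))) eq) (lemma₂ D x s)))
      where
      x≢0 : x ≢ 0ℤ
      x≢0 refl = *-≢0 (*-≢0 a≢0 (proj₁ squarefree)) (*-≢0 q≢0 q≢0) (trans eq (lemma D))
        where
        lemma : ∀ D → 0ℤ * 0ℤ - D * (0ℤ * 0ℤ) ≡ 0ℤ
        lemma = solve-∀
      lemma₁ : ∀ n q w → n * (q * w * (q * w)) ≡ n * (q * q) * (w * w)
      lemma₁ = solve-∀
      lemma₂ : ∀ D x s → (x * x - D * (0ℤ * 0ℤ)) * ((D - s * s) * (D - s * s))
        ≡ x * (D + s * s) * (x * (D + s * s)) - D * (x * (+ 2 * s) * (x * (+ 2 * s)))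
      lemma₂ = solve-∀

-- Infinitely many solutions

nondivisors⇒Infinite : ∀ {p} → Prime p → (P : Pred ℤ 0ℓ) →
  (∀ M → ¬ p ℕ.∣ M → ∃ λ d → d ∈ P × ¬ (+ p ∣ₛ d) × ¬ ∣ d ∣ ℕ.∣ M) → Infinite P
nondivisors⇒Infinite {p} p-prime P new = d , d-injective , λ i → proj₁ (proj₂ (new (M i) (p∤M i)))
  where
  -- M is the product of the |d| chosen so far, so that the next d, not dividing M, differs from all
  -- of them. None of them is divisible by p, so `new` applies again.
  bound : ℕ → ∃ λ M → ¬ p ℕ.∣ M
  bound zero    = 1 , prime∤1 p-prime
  bound (suc i) = let M , p∤M = bound i ; d , _ , p∤d , _ = new M p∤M in
    M ℕ.* ∣ d ∣ , prime∤ℕ* p-prime p∤M (p∤d ∘ ∣ᵤ⇒∣)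

  M : ℕ → ℕ
  M i = proj₁ (bound i)

  p∤M : ∀ i → ¬ p ℕ.∣ M i
  p∤M i = proj₂ (bound i)

  d : ℕ → ℤ
  d i = proj₁ (new (M i) (p∤M i))

  d∤M : ∀ i → ¬ ∣ d i ∣ ℕ.∣ M i
  d∤M i = proj₂ (proj₂ (proj₂ (new (M i) (p∤M i))))

  d∣M : ∀ {i j} → i ℕ.<′ j → ∣ d i ∣ ℕ.∣ M j
  d∣M {i} (ℕ.≤′-reflexive refl) = ℕ.n∣m*n (M i)
  d∣M {j = suc j} (ℕ.≤′-step i<j) = ℕ.∣m⇒∣m*n (∣ d j ∣) (d∣M i<j)

  d-distinct : ∀ {i j} → i ℕ.< j → d i ≢ d j
  d-distinct {j = j} i<j dᵢ≡dⱼ = d∤M j (subst (λ e → ∣ e ∣ ℕ.∣ M j) dᵢ≡dⱼ (d∣M (ℕ.≤⇒≤′ i<j)))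

  d-injective : Injective _≡_ _≡_ d
  d-injective {i} {j} dᵢ≡dⱼ with ℕ.<-cmp i j
  ... | tri< i<j _ _ = contradiction dᵢ≡dⱼ (d-distinct i<j)
  ... | tri≈ _ i≡j _ = i≡j
  ... | tri> _ _ j<i = contradiction (sym dᵢ≡dⱼ) (d-distinct j<i)

proposition3p5 : (f : ℤ[x].Poly) → ℤ[x].HasDegree f 2 → SeparableOverℚ f →
    (p : ℕ) → GoodPrime₂ p f →
    (m : ℤ) → Coprime m (+ p) →
    Infinite (λ d → d ∈ 𝒮 f × d ≡ m [mod p ])
proposition3p5 []              (a≢0 , _) = contradiction refl a≢0
proposition3p5 (_ ∷ [])        (a≢0 , _) = contradiction refl a≢0
proposition3p5 (_ ∷ _ ∷ [])    (a≢0 , _) = contradiction refl a≢0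
proposition3p5 (c ∷ b ∷ a ∷ g) f-degree@(a≢0 , g≡0) _ p good m m⊥p =
  nondivisors⇒Infinite prime _ λ M p∤M → extract (newSolution M p∤M)
  where
  open GoodPrime₂ good
  D = b * b - + 4 * (a * c)

  ∤-0⇒∤ : ∀ {i} → ¬ (i ≡ 0ℤ [mod p ]) → ¬ (+ p ∣ₛ i)
  ∤-0⇒∤ {i} i≢0 p∣i = i≢0 (∣⇒∣ᵤ (subst (+ p ∣ₛ_) (sym (+-identityʳ i)) p∣i))

  p∤D : ¬ (+ p ∣ₛ D)
  p∤D = ∤-0⇒∤ disc≉0

  p∤a : ¬ (+ p ∣ₛ a)
  p∤a = ∤-0⇒∤ (proj₁ (sameDegree 2 f-degree))

  p∤m : ¬ (+ p ∣ₛ m)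
  p∤m p∣m = prime∤1 prime (ℕ.∣-reflexive (m⊥p (∣⇒∣ᵤ p∣m , ℕ.∣-refl)))

  open Congruence p using (≈⇒∣-)
  open SquarefreeNorms D a m prime odd p∤D p∤a p∤m

  extract : ∀ {M} → NewSolution M →
            ∃ λ d → (d ∈ 𝒮 (c ∷ b ∷ a ∷ g) × d ≡ m [mod p ]) × ¬ (+ p ∣ₛ d) × ¬ ∣ d ∣ ℕ.∣ M
  extract record { d = d ; squarefreeNorm = d-norm ; d≈m = d≈m ; d∤M = d∤M } =
    d ,
    (IsNorm⇒∈𝒮 a b c g a≢0 (λ i → g≡0 (3 ℕ.+ i) (ℕ.m≤m+n 3 i)) (∤⇒≢0 p∤D) squarefree isNorm ,
     ∣⇒∣ᵤ (≈⇒∣- d≈m)) ,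
    p∤d , d∤M
    where open SquarefreeNorm d-norm
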